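{- Let $t,m$ be positive integers. Then for all non-negative integers $n$, \[ p_{mt,t}(n)= p(n)+\sum_{r=1}^{\infty}p\big(n-tr(2rm-m+2)\big)-\sum_{s=1}^{\infty}p\big(n-t(2s-1)(sm-m+1)\big). \]
   Context: $p(n)$ denotes the number of partitions of $n$ (non-increasing sequences of positive integers summing to $n$), with $p(0)=1$ and the convention $p(n)=0$ for negative integers $n$. For positive integers $A$ and $a$, and a partition $\lambda$, $\mathrm{mex}_{A,a}(\lambda)$ is the smallest positive integer congruent to $a$ modulo $A$ that is not a part of $\lambda$; $p_{A,a}(n)$ is the number of partitions $\lambda$ of $n$ with $\mathrm{mex}_{A,a}(\lambda)\equiv a\pmod{2A}$. -}

module Defs where

open import Data.Integer as ℤ using (ℤ; +_; -[1+_])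
open import Data.List using (List; []; _∷_; length; upTo; filter; cartesianProductWith)
open import Data.List.Membership.Propositional using (_∈_; _∉_)
open import Data.List.Membership.Propositional.Properties
  using (∈-cartesianProductWith⁺; ∈-cartesianProductWith⁻; ∈-filter⁺; ∈-filter⁻; ∈-upTo⁺)
open import Data.List.Properties using (∷-injective)
open import Data.List.Relation.Unary.All as All using (All; []; _∷_)
open import Data.List.Relation.Unary.Any using (here; there)
open import Data.List.Relation.Unary.Linked using (Linked; linked?)
open import Data.List.Relation.Unary.Unique.Propositional using (Unique; []; _∷_)
import Data.List.Relation.Unary.Unique.Propositional.Properties as Unique
open import Data.Nat
open import Data.Nat.Divisibility using (_∣_; _∣?_; m∣m*n)
open import Data.Nat.ListAction using (sum)
open import Data.Nat.Properties
open import Data.List.Membership.DecPropositional _≟_ using (_∈?_)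
open import Data.Product using (∃-syntax; _×_; _,_; proj₁; proj₂)
open import Function using (_∘_; _⇔_; mk⇔)
open import Relation.Binary.PropositionalEquality
open import Relation.Nullary using (Dec; yes; no; ¬?; _×-dec_; contradiction)
open import Relation.Unary using (Decidable)

IsPartition : ℕ → List ℕ → Set
IsPartition n xs = All (0 <_) xs × Linked _≥_ xs × sum xs ≡ n

isPartition? : ∀ n → Decidable (IsPartition n)
isPartition? n xs = All.all? (0 <?_) xs ×-dec linked? _≥?_ xs ×-dec sum xs ≟ n

-- All lists of length at most ℓ with entries in xs.
lists : List ℕ → ℕ → List (List ℕ)
lists xs zero    = [] ∷ []
lists xs (suc ℓ) = [] ∷ cartesianProductWith _∷_ xs (lists xs ℓ)

-- A partition of n has at most n parts, each at most n; `∈-partitions` and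
-- `partitions-unique` show that this lists every partition exactly once.
partitions : ℕ → List (List ℕ)
partitions n = filter (isPartition? n) (lists (upTo (suc n)) n)

p : ℤ → ℕ
p (+ n)    = length (partitions n)
p -[1+ _ ] = 0

_≡_[mod_] : ℕ → ℕ → ℕ → Set
b ≡ a [mod A ] = A ∣ ∣ b - a ∣

_≡?_[mod_] : ∀ b a A → Dec (b ≡ a [mod A ])
b ≡? a [mod A ] = A ∣? ∣ b - a ∣

IsMexCandidate : (A a : ℕ) → List ℕ → ℕ → Set
IsMexCandidate A a xs k = 0 < k × k ≡ a [mod A ] × k ∉ xs

isMexCandidate? : ∀ A a xs → Decidable (IsMexCandidate A a xs)
isMexCandidate? A a xs k = 0 <? k ×-dec k ≡? a [mod A ] ×-dec ¬? (k ∈? xs)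

Least : (ℕ → Set) → ℕ → Set
Least P k = P k × (∀ j → P j → k ≤ j)

least : ∀ {P : ℕ → Set} → Decidable P → ∀ k → P k → ∃[ j ] Least P j
least P? zero    pk = zero , pk , λ _ _ → z≤n
least {P} P? (suc k) pk with P? 0
... | yes p0 = 0 , p0 , λ _ _ → z≤n
... | no ¬p0 with least {P ∘ suc} (P? ∘ suc) k pk
...   | j , pj , j≤ = suc j , pj , λ where
          zero    p0 → contradiction p0 ¬p0
          (suc i) pi → s≤s (j≤ i pi)

∈⇒≤sum : ∀ {x} xs → x ∈ xs → x ≤ sum xs
∈⇒≤sum (x ∷ xs) (here refl) = m≤m+n x (sum xs)
∈⇒≤sum (y ∷ xs) (there x∈)  = ≤-trans (∈⇒≤sum xs x∈) (m≤n+m (sum xs) y)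

mexCandidate : ∀ A a .{{_ : NonZero A}} xs → IsMexCandidate A a xs (a + A * suc (sum xs))
mexCandidate A a xs =
    ≤-trans (s≤s z≤n) big
  , subst (A ∣_) (sym (trans (∣-∣-comm (a + A * suc (sum xs)) a) (∣m-m+n∣≡n a _)))
      (m∣m*n (suc (sum xs)))
  , λ k∈ → <⇒≱ big (∈⇒≤sum xs k∈)
  where
  big : suc (sum xs) ≤ a + A * suc (sum xs)
  big = ≤-trans (m≤n*m (suc (sum xs)) A) (m≤n+m _ a)

mexΣ : ∀ A a .{{_ : NonZero A}} xs → ∃[ k ] Least (IsMexCandidate A a xs) k
mexΣ A a xs = least (isMexCandidate? A a xs) _ (mexCandidate A a xs)

mex : (A a : ℕ) .{{_ : NonZero A}} → List ℕ → ℕ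
mex A a xs = proj₁ (mexΣ A a xs)

mex-least : ∀ A a .{{_ : NonZero A}} xs → Least (IsMexCandidate A a xs) (mex A a xs)
mex-least A a xs = proj₂ (mexΣ A a xs)

pmex : (A a : ℕ) .{{_ : NonZero A}} → ℕ → ℕ
pmex A a n = length (filter (λ xs → mex A a xs ≡? a [mod 2 * A ]) (partitions n))

-- ∑₁ f N = f 1 + … + f N
∑₁ : (ℕ → ℤ) → ℕ → ℤ
∑₁ f zero    = ℤ.0ℤ
∑₁ f (suc N) = ∑₁ f N ℤ.+ f (suc N)

-- s is the value of the infinite series f 1 + f 2 + …: a sequence of integers
-- converges exactly when it is eventually constant.
HasSum₁ : (ℕ → ℤ) → ℤ → Set
HasSum₁ f s = ∃[ N ] (∀ M → N ≤ M → ∑₁ f M ≡ s)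

HasSum₁-unique : ∀ {f s s′} → HasSum₁ f s → HasSum₁ f s′ → s ≡ s′
HasSum₁-unique (N , h) (N′ , h′) =
  trans (sym (h (N ⊔ N′) (m≤m⊔n N N′))) (h′ (N ⊔ N′) (m≤n⊔m N N′))

lists-unique : ∀ {xs} → Unique xs → ∀ ℓ → Unique (lists xs ℓ)
lists-unique xs! zero    = [] ∷ []
lists-unique {xs} xs! (suc ℓ) =
  All.tabulate []≢
    ∷ Unique.cartesianProductWith⁺ _∷_ ∷-injective xs! (lists-unique xs! ℓ)
  where
  []≢ : ∀ {ys} → ys ∈ cartesianProductWith _∷_ xs (lists xs ℓ) → [] ≢ ys
  []≢ ys∈ refl with ∈-cartesianProductWith⁻ _∷_ xs (lists xs ℓ) ys∈
  ... | _ , _ , _ , _ , ()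

∈-lists : ∀ {xs} ℓ {ys} → All (0 <_) ys → All (_∈ xs) ys → sum ys ≤ ℓ → ys ∈ lists xs ℓ
∈-lists zero    []        _          _ = here refl
∈-lists (suc ℓ) []        _          _ = here refl
∈-lists zero    (s≤s _ ∷ _)   _          ()
∈-lists (suc ℓ) (s≤s {n = y} _ ∷ 0<ys) (y∈ ∷ ys∈) (s≤s h) =
  there (∈-cartesianProductWith⁺ _∷_ y∈ (∈-lists ℓ 0<ys ys∈ (≤-trans (m≤n+m _ y) h)))

partitions-unique : ∀ n → Unique (partitions n)
partitions-unique n =
  Unique.filter⁺ (isPartition? n) {lists (upTo (suc n)) n}
    (lists-unique (Unique.upTo⁺ (suc n)) n)

∈-partitions : ∀ n {xs} → xs ∈ partitions n ⇔ IsPartition n xs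
∈-partitions n {xs} = mk⇔ sound complete
  where
  sound : xs ∈ partitions n → IsPartition n xs
  sound xs∈ = proj₂ (∈-filter⁻ (isPartition? n) {xs = lists (upTo (suc n)) n} xs∈)

  complete : IsPartition n xs → xs ∈ partitions n
  complete h@(0<xs , _ , refl) = ∈-filter⁺ (isPartition? n)
    (∈-lists n 0<xs (All.tabulate (λ x∈ → ∈-upTo⁺ (s≤s (∈⇒≤sum xs x∈)))) ≤-refl) h

-- Let k(λ) be the number of the terms a, a+A, a+2A, … contained in λ before the
-- first gap, so that mex(λ) = a + k(λ)A and the partitions counted by p_{A,a} are
-- those with k even. Deleting the parts a, …, a+(j-1)A shows that
-- #{λ : k(λ) ≥ j} = p(n - (a + … + (a+(j-1)A))), and alternating over j gives
--   #{k even} = #{k ≥ 0} - #{k ≥ 1} + #{k ≥ 2} - ….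
-- For A = mt and a = t, even j = 2r and odd j = 2s-1 yield the two series.

module Submission where

open import Defs
open import Data.Nat as ℕ using (ℕ; NonZero)
open import Data.Nat.Properties using (m*n≢0)
open import Data.Integer using (ℤ; +_; _+_; _-_; _*_)
open import Data.Product using (∃₂; _×_)
open import Relation.Binary.PropositionalEquality using (_≡_)

open import Data.Integer using (0ℤ)
open import Data.Integer.Properties as ℤ using (pos-*; +-identityʳ; [+m]-[+n]≡m⊖n; ⊖-<)
open import Data.Integer.Tactic.RingSolver using (solve-∀)
open import Data.List using (List; []; _∷_; _++_; length; map; filter; downFrom)
open import Data.List.Membership.DecPropositional ℕ._≟_ using (_∈?_)
open import Data.List.Membership.Propositional using (_∈_; _∉_)
open import Data.List.Membership.Propositional.Properties
  using (∈-∃++; ∈-filter⁺; ∈-filter⁻; ∈-map⁺; ∈-map⁻; ∈-downFrom⁺; ∈-downFrom⁻)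
open import Data.List.Membership.Propositional.Properties.WithK using (unique∧set⇒bag)
open import Data.List.Properties using (∷-injective; filter-all; filter-none; filter-≐; length-map)
open import Data.List.Relation.Binary.BagAndSetEquality using (∼bag⇒↭)
open import Data.List.Relation.Binary.Permutation.Propositional using (_↭_; ↭⇒↭ₛ; ↭-sym; ↭-trans; prep)
open import Data.List.Relation.Binary.Permutation.Propositional.Properties
  using (All-resp-↭; ∈-resp-↭; ↭-length; shift)
open import Data.List.Relation.Binary.Pointwise using (Pointwise-≡⇒≡)
open import Data.List.Relation.Unary.All as All using (All; []; _∷_)
import Data.List.Relation.Unary.All.Properties as All
open import Data.List.Relation.Unary.Any using (here; there)
import Data.List.Relation.Unary.Sorted.TotalOrder.Properties as Sorted
open import Data.List.Relation.Unary.Unique.Propositional using (Unique; []; _∷_)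
import Data.List.Relation.Unary.Unique.Propositional.Properties as Unique
import Data.List.Sort.InsertionSort.Base
import Data.List.Sort.InsertionSort.Properties
open import Data.Nat using (zero; suc; pred; _≤_; _<_; s≤s; z≤n)
open import Data.Nat.Divisibility
  using (_∣_; divides; ∣⇒≤; ∣m+n∣m⇒∣n; *-cancelʳ-∣; n∣m*n)
open import Data.Nat.ListAction using (sum)
open import Data.Nat.ListAction.Properties using (sum-↭)
open import Data.Nat.Properties as ℕ hiding (+-identityʳ)
open import Data.Product using (∃-syntax; _,_; proj₁; proj₂)
open import Data.Sum using (_⊎_; inj₁; inj₂; [_,_]′)
open import Function using (_∘_; case_of_; Equivalence; mk⇔)
open import Relation.Binary.Bundles using (DecTotalOrder)
import Relation.Binary.Construct.Flip.EqAndOrd as Flip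
open import Relation.Binary.PropositionalEquality
  using (refl; sym; trans; cong; cong₂; subst; _≢_; module ≡-Reasoning)
open import Relation.Nullary using (¬_; yes; no; ¬?; _×-dec_; contradiction)
open import Relation.Unary using (Pred; Decidable; U; _≐_; _∪_; _⊥_)
open import Data.Unit using (tt)
open import Level using (0ℓ)

-- Partitions are non-increasing, so the order is flipped to make insertion sort produce lists of
-- that shape.
≥-decTotalOrder : DecTotalOrder 0ℓ 0ℓ 0ℓ
≥-decTotalOrder = Flip.decTotalOrder ≤-decTotalOrder

open Data.List.Sort.InsertionSort.Base ≥-decTotalOrder using (insert; sort)
open Data.List.Sort.InsertionSort.Properties ≥-decTotalOrder
  using (insert-↭; insert-↗; sort-↭; sort-↗)

-- Counting list elements by a predicate

count : ∀ {A : Set} {P : Pred A 0ℓ} → Decidable P → List A → ℕ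
count P? xs = length (filter P? xs)

module _ {A : Set} where

  count-cong : ∀ {P Q : Pred A 0ℓ} (P? : Decidable P) (Q? : Decidable Q) → P ≐ Q →
               ∀ xs → count P? xs ≡ count Q? xs
  count-cong P? Q? P≐Q xs = cong length (filter-≐ P? Q? P≐Q xs)

  count-none : ∀ {P : Pred A 0ℓ} (P? : Decidable P) xs → (∀ {x} → x ∈ xs → ¬ P x) →
               count P? xs ≡ 0
  count-none P? xs ¬P = cong length (filter-none P? (All.tabulate ¬P))

  count-∪ : ∀ {P Q R : Pred A 0ℓ} (P? : Decidable P) (Q? : Decidable Q) (R? : Decidable R) →
            P ≐ (Q ∪ R) → Q ⊥ R → ∀ xs → count P? xs ≡ count Q? xs ℕ.+ count R? xs
  count-∪ P? Q? R? P≐ Q⊥R [] = refl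
  count-∪ P? Q? R? P≐ Q⊥R (x ∷ xs) with ih ← count-∪ P? Q? R? P≐ Q⊥R xs | P? x | Q? x | R? x
  ... | _     | yes q | yes r = contradiction (q , r) Q⊥R
  ... | yes _ | yes _ | no _  = cong suc ih
  ... | yes _ | no _  | yes _ = trans (cong suc ih) (sym (ℕ.+-suc _ _))
  ... | yes p | no ¬q | no ¬r = contradiction (proj₁ P≐ p) [ ¬q , ¬r ]′
  ... | no ¬p | yes q | no _  = contradiction (proj₂ P≐ (inj₁ q)) ¬p
  ... | no ¬p | no _  | yes r = contradiction (proj₂ P≐ (inj₂ r)) ¬p
  ... | no _  | no _  | no _  = ih

-- Counting partitions with prescribed parts

module _ {a ℓ₁ ℓ₂} (O : DecTotalOrder a ℓ₁ ℓ₂) where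
  open DecTotalOrder O using (module Eq) renaming (_≤?_ to _≼?_; reflexive to ≼-reflexive)
  open Data.List.Sort.InsertionSort.Base O renaming (insert to insertᴼ)

  -- If `x` stops at the head of one list but passes the head of the other, the equal results force
  -- that second head to be `x` itself, which reflexivity forbids `x` to pass. This injectivity
  -- keeps the list of enlarged partitions free of duplicates.
  insert-injective : ∀ x {xs ys} → insertᴼ x xs ≡ insertᴼ x ys → xs ≡ ys
  insert-injective x {[]} {[]} _ = refl
  insert-injective x {[]} {z ∷ zs} eq with x ≼? z
  ... | yes _  with _ , () ← ∷-injective eq
  ... | no x⋠z with refl , _ ← ∷-injective eq = contradiction (≼-reflexive Eq.refl) x⋠z
  insert-injective x {y ∷ ys} {[]} eq with x ≼? y
  ... | yes _  with _ , () ← ∷-injective eq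
  ... | no x⋠y with refl , _ ← ∷-injective eq = contradiction (≼-reflexive Eq.refl) x⋠y
  insert-injective x {y ∷ ys} {z ∷ zs} eq with x ≼? y | x ≼? z
  ... | yes _  | yes _  = proj₂ (∷-injective eq)
  ... | yes _  | no x⋠z with refl , _ ← ∷-injective eq = contradiction (≼-reflexive Eq.refl) x⋠z
  ... | no x⋠y | yes _  with refl , _ ← ∷-injective eq = contradiction (≼-reflexive Eq.refl) x⋠y
  ... | no _   | no _   with refl , eq′ ← ∷-injective eq = cong (y ∷_) (insert-injective x eq′)

insert-isPartition : ∀ {d n xs} → 0 < d → IsPartition n xs → IsPartition (d ℕ.+ n) (insert d xs)
insert-isPartition {d} {n} {xs} 0<d (pos , xs↘ , refl) =
    All-resp-↭ (↭-sym (insert-↭ d xs)) (0<d ∷ pos)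
  , insert-↗ d xs↘
  , sum-↭ (insert-↭ d xs)

-- A sorted list is determined by its multiset of entries, so equality of partitions can be checked
-- up to permutation.
isPartition-↭⇒≡ : ∀ {n xs ys} → IsPartition n xs → IsPartition n ys → xs ↭ ys → xs ≡ ys
isPartition-↭⇒≡ (_ , xs↘ , _) (_ , ys↘ , _) xs↭ys = Pointwise-≡⇒≡
  (Sorted.↗↭↗⇒≋ (DecTotalOrder.totalOrder ≥-decTotalOrder) xs↘ ys↘ (↭⇒↭ₛ xs↭ys))

remove-part : ∀ {d n xs} → 0 < d → IsPartition (d ℕ.+ n) xs → d ∈ xs →
              ∃[ ys ] IsPartition n ys × xs ≡ insert d ys
remove-part {d} {n} 0<d h@(pos , _ , Σ≡) d∈ with us , vs , refl ← ∈-∃++ d∈ =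
  ys , ys-isPartition , isPartition-↭⇒≡ h (insert-isPartition 0<d ys-isPartition)
                          (↭-trans xs↭ (↭-sym (insert-↭ d ys)))
  where
  -- Sorting the remainder afresh avoids showing that deletion preserves the order.
  ys = sort (us ++ vs)

  xs↭ : us ++ d ∷ vs ↭ d ∷ ys
  xs↭ = ↭-trans (shift d us vs) (prep d (↭-sym (sort-↭ (us ++ vs))))

  ys-isPartition : IsPartition n ys
  ys-isPartition =
      All.tail (All-resp-↭ xs↭ pos)
    , sort-↗ (us ++ vs)
    , ℕ.+-cancelˡ-≡ d _ _ (trans (sym (sum-↭ xs↭)) Σ≡)

contains? : ∀ ds → Decidable (λ xs → All (_∈ xs) ds)
contains? ds xs = All.all? (_∈? xs) ds

∈-containing⁺ : ∀ {n ds xs} → IsPartition n xs → All (_∈ xs) ds →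
                xs ∈ filter (contains? ds) (partitions n)
∈-containing⁺ {n} {ds} h ⊇ds = ∈-filter⁺ (contains? ds) (Equivalence.from (∈-partitions n) h) ⊇ds

∈-containing⁻ : ∀ n {ds xs} → xs ∈ filter (contains? ds) (partitions n) →
                IsPartition n xs × All (_∈ xs) ds
∈-containing⁻ n {ds} xs∈ with h , ⊇ds ← ∈-filter⁻ (contains? ds) {xs = partitions n} xs∈ =
  Equivalence.to (∈-partitions n) h , ⊇ds

-- Inserting one copy of `d` is a bijection between the two families. Both lists are duplicate-free
-- with the same members, hence permutations of each other, hence of equal length.
count-containing-∷ : ∀ {d ds} n → 0 < d → All (d ≢_) ds →
  count (contains? (d ∷ ds)) (partitions (d ℕ.+ n)) ≡ count (contains? ds) (partitions n)
count-containing-∷ {d} {ds} n 0<d d∉ds = trans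
  (↭-length (∼bag⇒↭ (unique∧set⇒bag
    (Unique.filter⁺ (contains? (d ∷ ds)) (partitions-unique (d ℕ.+ n)))
    (Unique.map⁺ (insert-injective ≥-decTotalOrder d) (Unique.filter⁺ (contains? ds) (partitions-unique n)))
    (mk⇔ to from))))
  (length-map (insert d) (filter (contains? ds) (partitions n)))
  where
  -- Here the distinctness of `d` from `ds` enters: the deleted copy of `d` is none of the other
  -- prescribed parts, so those survive.
  removed : ∀ {e ys} → d ≢ e → e ∈ insert d ys → e ∈ ys
  removed {ys = ys} d≢e e∈ with ∈-resp-↭ (insert-↭ d ys) e∈
  ... | here e≡d   = contradiction (sym e≡d) d≢e
  ... | there e∈ys = e∈ys

  to : ∀ {xs} → xs ∈ filter (contains? (d ∷ ds)) (partitions (d ℕ.+ n)) →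
       xs ∈ map (insert d) (filter (contains? ds) (partitions n))
  to xs∈ with h , d∈ ∷ ⊇ds ← ∈-containing⁻ (d ℕ.+ n) xs∈
         with ys , hys , refl ← remove-part 0<d h d∈ =
    ∈-map⁺ (insert d) (∈-containing⁺ hys
      (All.zipWith (λ (d≢e , e∈) → removed d≢e e∈) (d∉ds , ⊇ds)))

  from : ∀ {xs} → xs ∈ map (insert d) (filter (contains? ds) (partitions n)) →
         xs ∈ filter (contains? (d ∷ ds)) (partitions (d ℕ.+ n))
  from xs∈ with ys , ys∈ , refl ← ∈-map⁻ (insert d) xs∈
           with h , ⊇ds ← ∈-containing⁻ n ys∈ =
    ∈-containing⁺ (insert-isPartition 0<d h)
      (d∷ys⊆ (here refl) ∷ All.map (d∷ys⊆ ∘ there) ⊇ds)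
    where
    d∷ys⊆ : ∀ {e} → e ∈ d ∷ ys → e ∈ insert d ys
    d∷ys⊆ = ∈-resp-↭ (↭-sym (insert-↭ d ys))

p-negative : ∀ {n k} → n < k → p (+ n - + k) ≡ 0
p-negative {n} {k} n<k rewrite [+m]-[+n]≡m⊖n n k | ⊖-< n<k
  -- The difference is now the negation of `k ∸ n`; exposing that number as a successor lets the
  -- clause of `p` for negative integers fire.
  with suc _ ← k ℕ.∸ n | s≤s _ ← m<n⇒0<n∸m n<k = refl

part≤ : ∀ {n xs d} → xs ∈ partitions n → d ∈ xs → d ≤ n
part≤ {n} {xs} xs∈ d∈ with _ , _ , refl ← Equivalence.to (∈-partitions n) xs∈ = ∈⇒≤sum xs d∈

-- Induction on `ds`, deleting one prescribed part at a time. If a part exceeds `n`, no partition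
-- contains it, and the right side vanishes by the convention for negative arguments.
count-containing : ∀ {ds} n → Unique ds → All (0 <_) ds →
  count (contains? ds) (partitions n) ≡ p (+ n - + sum ds)
count-containing {[]} n _ _ = trans
  (cong length (filter-all (contains? []) {partitions n} (All.tabulate (λ _ → []))))
  (cong p (sym (+-identityʳ (+ n))))
count-containing {d ∷ ds} n (d∉ds ∷ ds!) (0<d ∷ 0<ds) with ℕ.≤-<-connex d n
... | inj₂ n<d = trans
  (count-none (contains? (d ∷ ds)) (partitions n)
    (λ { xs∈ (d∈ ∷ _) → <⇒≱ n<d (part≤ xs∈ d∈) }))
  (sym (p-negative (<-≤-trans n<d (m≤m+n d (sum ds)))))
... | inj₁ d≤n with k , refl ← m≤n⇒∃[o]m+o≡n d≤n = begin
  count (contains? (d ∷ ds)) (partitions (d ℕ.+ k)) ≡⟨ count-containing-∷ k 0<d d∉ds ⟩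
  count (contains? ds) (partitions k)               ≡⟨ count-containing k ds! 0<ds ⟩
  p (+ k - + sum ds)                                ≡⟨ cong p (cancel (+ d) (+ k) (+ sum ds)) ⟩
  p (+ (d ℕ.+ k) - + (d ℕ.+ sum ds))                ∎
  where
  open ≡-Reasoning
  cancel : ∀ d k s → k - s ≡ (d + k) - (d + s)
  cancel = solve-∀

-- Partitions by their minimal excludant

module _ (A a : ℕ) .{{_ : NonZero A}} .{{_ : NonZero a}} (a≤A : a ≤ A) where

  candidate : ℕ → ℕ
  candidate j = a ℕ.+ j ℕ.* A

  candidate>0 : ∀ j → 0 < candidate j
  candidate>0 j = ≤-trans (ℕ.>-nonZero⁻¹ a) (m≤m+n a (j ℕ.* A))

  candidate-injective : ∀ {i j} → candidate i ≡ candidate j → i ≡ j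
  candidate-injective {i} {j} eq = *-cancelʳ-≡ i j A (ℕ.+-cancelˡ-≡ a _ _ eq)

  ∣candidate-a∣ : ∀ j → ℕ.∣ candidate j - a ∣ ≡ j ℕ.* A
  ∣candidate-a∣ j = trans (∣-∣-comm (candidate j) a) (∣m-m+n∣≡n a (j ℕ.* A))

  -- For `k` at least `a` the quotient is the index. A positive `k` below `a` would differ from `a`
  -- by a positive number less than `A`, since `a ≤ A`, and no such number is a multiple of `A`.
  ≡mod⇒candidate : ∀ k → 0 < k → k ≡ a [mod A ] → ∃[ j ] k ≡ candidate j
  ≡mod⇒candidate k 0<k A∣ with ℕ.≤-<-connex a k
  ... | inj₁ a≤k with divides j eq ← A∣ = j , (begin
    k                      ≡⟨ m+[n∸m]≡n a≤k ⟨
    a ℕ.+ (k ℕ.∸ a)        ≡⟨ cong (a ℕ.+_) (m≤n⇒∣n-m∣≡n∸m a≤k) ⟨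
    a ℕ.+ ℕ.∣ k - a ∣      ≡⟨ cong (a ℕ.+_) eq ⟩
    candidate j            ∎)
    where open ≡-Reasoning
  ... | inj₂ k<a = contradiction
    (∣⇒≤ {{ℕ.>-nonZero (m<n⇒0<n∸m k<a)}} (subst (A ∣_) (m≤n⇒∣m-n∣≡n∸m (<⇒≤ k<a)) A∣))
    (<⇒≱ (<-≤-trans (∸-monoʳ-< 0<k (<⇒≤ k<a)) a≤A))

  mexIndexΣ : ∀ xs → ∃[ j ] mex A a xs ≡ candidate j
  mexIndexΣ xs with (0<k , A∣ , _) , _ ← mex-least A a xs = ≡mod⇒candidate _ 0<k A∣

  -- This is the k(λ) of the overview.
  mexIndex : List ℕ → ℕ
  mexIndex = proj₁ ∘ mexIndexΣ

  mex≡candidate : ∀ xs → mex A a xs ≡ candidate (mexIndex xs)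
  mex≡candidate = proj₂ ∘ mexIndexΣ

  candidate-mexIndex∉ : ∀ xs → candidate (mexIndex xs) ∉ xs
  candidate-mexIndex∉ xs = subst (_∉ xs) (mex≡candidate xs) (proj₂ (proj₂ (proj₁ (mex-least A a xs))))

  <mexIndex⇒candidate∈ : ∀ xs {j} → j < mexIndex xs → candidate j ∈ xs
  <mexIndex⇒candidate∈ xs {j} j<k with candidate j ∈? xs
  ... | yes c∈ = c∈
  ... | no  c∉ = contradiction
    (subst (_≤ candidate j) (mex≡candidate xs) (proj₂ (mex-least A a xs) (candidate j)
      (candidate>0 j , divides j (∣candidate-a∣ j) , c∉)))
    (<⇒≱ (ℕ.+-monoʳ-< a (*-monoˡ-< A j<k)))

  -- Listing downwards puts the newest term at the head, so the sum for `suc j` unfolds by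
  -- computation to the sum for `j` plus one term.
  candidates : ℕ → List ℕ
  candidates j = map candidate (downFrom j)

  -- All candidates before the mex are parts, by its minimality; conversely, an index below `j`
  -- would put the mex itself among the parts.
  ≤mexIndex≐contains : ∀ j → (λ xs → j ≤ mexIndex xs) ≐ (λ xs → All (_∈ xs) (candidates j))
  ≤mexIndex≐contains j =
      (λ {xs} j≤k → All.map⁺ (All.tabulate
        (λ i∈ → <mexIndex⇒candidate∈ xs (<-≤-trans (∈-downFrom⁻ i∈) j≤k))))
    , (λ {xs} ⊇c → ≮⇒≥ (λ k<j → candidate-mexIndex∉ xs
        (All.lookup (All.map⁻ ⊇c) (∈-downFrom⁺ k<j))))

  count≥ : ℕ → ℕ → ℕ
  count≥ n j = count (λ xs → j ≤? mexIndex xs) (partitions n)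

  count≥≡p : ∀ n j → count≥ n j ≡ p (+ n - + sum (candidates j))
  count≥≡p n j = trans
    (count-cong _ (contains? (candidates j)) (≤mexIndex≐contains j) (partitions n))
    (count-containing n
      (Unique.map⁺ candidate-injective (Unique.downFrom⁺ j))
      (All.map⁺ (All.tabulate {xs = downFrom j} (λ {i} _ → candidate>0 i))))

  -- With index `suc k`, the candidate numbered `k` is a part; it is at least `1 + k` and at most
  -- `n`. This bound makes all the series finite.
  mexIndex≤ : ∀ {n xs} → xs ∈ partitions n → mexIndex xs ≤ n
  mexIndex≤ {n} {xs} xs∈ with mexIndex xs | <mexIndex⇒candidate∈ xs
  ... | zero  | _  = z≤n
  ... | suc k | c∈ = ≤-trans
    (ℕ.+-mono-≤ (ℕ.>-nonZero⁻¹ a) (m≤m*n k A))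
    (part≤ xs∈ (c∈ (n<1+n k)))

  count≥-zero : ∀ {n j} → n < j → count≥ n j ≡ 0
  count≥-zero {n} {j} n<j = count-none _ (partitions n)
    (λ xs∈ j≤k → <⇒≱ n<j (≤-trans j≤k (mexIndex≤ xs∈)))

  -- IsEven xs says that mexIndex xs is even.
  IsEven : List ℕ → Set
  IsEven xs = mex A a xs ≡ a [mod 2 ℕ.* A ]

  isEven? : Decidable IsEven
  isEven? xs = mex A a xs ≡? a [mod 2 ℕ.* A ]

  2*mexIndex⇒IsEven : ∀ {xs} M → M ℕ.* 2 ≡ mexIndex xs → IsEven xs
  2*mexIndex⇒IsEven {xs} M eq = divides M (begin
    ℕ.∣ mex A a xs - a ∣               ≡⟨ cong (λ k → ℕ.∣ k - a ∣) (mex≡candidate xs) ⟩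
    ℕ.∣ candidate (mexIndex xs) - a ∣  ≡⟨ ∣candidate-a∣ (mexIndex xs) ⟩
    mexIndex xs ℕ.* A                  ≡⟨ cong (ℕ._* A) eq ⟨
    M ℕ.* 2 ℕ.* A                      ≡⟨ *-assoc M 2 A ⟩
    M ℕ.* (2 ℕ.* A)                    ∎)
    where open ≡-Reasoning

  -- Cancelling `A` from the divisibility by `2A` leaves an odd index divisible by 2.
  1+2*mexIndex⇒¬IsEven : ∀ {xs} M → suc (M ℕ.* 2) ≡ mexIndex xs → ¬ IsEven xs
  1+2*mexIndex⇒¬IsEven {xs} M eq 2A∣ = contradiction (∣⇒≤ 2∣1) λ { (s≤s ()) }
    where
    2A∣kA : 2 ℕ.* A ∣ mexIndex xs ℕ.* A
    2A∣kA = subst (2 ℕ.* A ∣_)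
      (trans (cong (λ k → ℕ.∣ k - a ∣) (mex≡candidate xs)) (∣candidate-a∣ (mexIndex xs))) 2A∣

    2∣1 : 2 ∣ 1
    2∣1 = ∣m+n∣m⇒∣n
      (subst (2 ∣_) (trans (sym eq) (ℕ.+-comm 1 (M ℕ.* 2))) (*-cancelʳ-∣ A 2A∣kA))
      (n∣m*n M)

  -- The error left when the alternating sum of the count≥ n j stops at j = 2M.
  countOdd≥ : ℕ → ℕ → ℕ
  countOdd≥ n M = count (λ xs → M ℕ.* 2 ≤? mexIndex xs ×-dec ¬? (isEven? xs)) (partitions n)

  -- Both sides are the same three-term sum once the partitions of index exactly 2M+1 are split off:
  -- on the left from the first count, on the right from the error term.
  count≥-step : ∀ n M → count≥ n (suc (M ℕ.* 2)) ℕ.+ countOdd≥ n (suc M) ≡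
                        count≥ n (suc M ℕ.* 2) ℕ.+ countOdd≥ n M
  count≥-step n M = begin
    count≥ n (suc (M ℕ.* 2)) ℕ.+ countOdd≥ n (suc M)
      ≡⟨ cong (ℕ._+ countOdd≥ n (suc M)) (count-∪ _ _ at? ≥-split
           (λ (2+2M≤k , eq) → <⇒≢ 2+2M≤k eq) (partitions n)) ⟩
    count≥ n (suc M ℕ.* 2) ℕ.+ at ℕ.+ countOdd≥ n (suc M)
      ≡⟨ ℕ.+-assoc (count≥ n (suc M ℕ.* 2)) at _ ⟩
    count≥ n (suc M ℕ.* 2) ℕ.+ (at ℕ.+ countOdd≥ n (suc M))
      ≡⟨ cong (count≥ n (suc M ℕ.* 2) ℕ.+_) (count-∪ _ at? _ odd≥-split
           (λ (eq , 2+2M≤k , _) → <⇒≢ 2+2M≤k eq) (partitions n)) ⟨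
    count≥ n (suc M ℕ.* 2) ℕ.+ countOdd≥ n M
      ∎
    where
    open ≡-Reasoning

    at? : Decidable (λ xs → suc (M ℕ.* 2) ≡ mexIndex xs)
    at? xs = suc (M ℕ.* 2) ℕ.≟ mexIndex xs

    at : ℕ
    at = count at? (partitions n)

    ≥-split : (λ xs → suc (M ℕ.* 2) ≤ mexIndex xs) ≐
              ((λ xs → suc M ℕ.* 2 ≤ mexIndex xs) ∪ (λ xs → suc (M ℕ.* 2) ≡ mexIndex xs))
    ≥-split = m≤n⇒m<n∨m≡n , [ <⇒≤ , ≤-reflexive ]′

    odd≥-split : (λ xs → M ℕ.* 2 ≤ mexIndex xs × ¬ IsEven xs) ≐
                 ((λ xs → suc (M ℕ.* 2) ≡ mexIndex xs) ∪
                  (λ xs → suc M ℕ.* 2 ≤ mexIndex xs × ¬ IsEven xs))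
    odd≥-split = to , from
      where
      to : ∀ {xs} → M ℕ.* 2 ≤ mexIndex xs × ¬ IsEven xs →
           suc (M ℕ.* 2) ≡ mexIndex xs ⊎ suc M ℕ.* 2 ≤ mexIndex xs × ¬ IsEven xs
      -- The index 2M is even and so excluded; what remains is 2M+1 or at least 2M+2.
      to (2M≤k , odd) with m≤n⇒m<n∨m≡n 2M≤k
      ... | inj₂ eq = contradiction (2*mexIndex⇒IsEven M eq) odd
      ... | inj₁ 2M<k with m≤n⇒m<n∨m≡n 2M<k
      ...   | inj₁ 1+2M<k = inj₂ (1+2M<k , odd)
      ...   | inj₂ eq     = inj₁ eq

      from : ∀ {xs} → suc (M ℕ.* 2) ≡ mexIndex xs ⊎ suc M ℕ.* 2 ≤ mexIndex xs × ¬ IsEven xs →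
             M ℕ.* 2 ≤ mexIndex xs × ¬ IsEven xs
      from (inj₁ eq)             = ≤-trans (n≤1+n _) (≤-reflexive eq) , 1+2*mexIndex⇒¬IsEven M eq
      from (inj₂ (2+2M≤k , odd)) = ≤-trans (m≤n+m _ 2) 2+2M≤k , odd

  -- At `suc r`, `pred (s * 2)` computes to `suc (r * 2)`. Its truncated value at 0 is harmless,
  -- because `∑₁` starts at 1.
  evenTerm oddTerm : ℕ → ℕ → ℤ
  evenTerm n r = + count≥ n (r ℕ.* 2)
  oddTerm  n s = + count≥ n (pred (s ℕ.* 2))

  -- A finite form of the alternating sum with its exact error, arranged so that nothing is
  -- subtracted. It starts from the split of all partitions into even and odd index; `count≥-step`
  -- advances it by one pair of terms.
  pmex-partial : ∀ n M → + pmex A a n + ∑₁ (oddTerm n) M + + countOdd≥ n M ≡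
                         + p (+ n) + ∑₁ (evenTerm n) M
  pmex-partial n zero = begin
    + pmex A a n + 0ℤ + + countOdd≥ n 0   ≡⟨ cong (_+ + countOdd≥ n 0) (+-identityʳ (+ pmex A a n)) ⟩
    + (pmex A a n ℕ.+ countOdd≥ n 0)      ≡⟨ cong +_ (count-∪ (λ _ → yes tt) isEven? _ split
                                                (λ (e , _ , o) → o e) (partitions n)) ⟨
    -- The total is recast as a count under the always true predicate, so that `count-∪` can split
    -- it.
    + count {P = U} (λ _ → yes tt) (partitions n)
      ≡⟨ cong (+_ ∘ length) (filter-all {P = U} (λ _ → yes tt) {partitions n} (All.tabulate (λ _ → tt))) ⟩
    + p (+ n)                             ≡⟨ +-identityʳ (+ p (+ n)) ⟨
    + p (+ n) + 0ℤ                        ∎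
    where
    open ≡-Reasoning
    split : U ≐ (IsEven ∪ (λ xs → 0 ≤ mexIndex xs × ¬ IsEven xs))
    split = (λ {xs} _ → case isEven? xs of λ where
                (yes e) → inj₁ e
                (no  o) → inj₂ (z≤n , o))
          , (λ _ → tt)
  pmex-partial n (suc M) = begin
    x + (o + o′) + r′          ≡⟨ regroup x o o′ r′ ⟩
    x + o + (o′ + r′)          ≡⟨ cong (λ k → x + o + + k) (count≥-step n M) ⟩
    x + o + (e′ + r)           ≡⟨ swap x o e′ r ⟩
    x + o + r + e′             ≡⟨ cong (_+ e′) (pmex-partial n M) ⟩
    + p (+ n) + e + e′         ≡⟨ ℤ.+-assoc (+ p (+ n)) e e′ ⟩
    + p (+ n) + (e + e′)       ∎
    where
    open ≡-Reasoning
    x  = + pmex A a n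
    o  = ∑₁ (oddTerm n) M
    o′ = oddTerm n (suc M)
    e  = ∑₁ (evenTerm n) M
    e′ = evenTerm n (suc M)
    r  = + countOdd≥ n M
    r′ = + countOdd≥ n (suc M)
    regroup : ∀ x o o′ r′ → x + (o + o′) + r′ ≡ x + o + (o′ + r′)
    regroup = solve-∀
    swap : ∀ x o e′ r → x + o + (e′ + r) ≡ x + o + r + e′
    swap = solve-∀

  -- At `M = suc n` the error is zero: an index is at most `n`, hence below 2(n+1).
  pmex-∑₁ : ∀ n → + pmex A a n ≡ + p (+ n) + ∑₁ (evenTerm n) (suc n) - ∑₁ (oddTerm n) (suc n)
  pmex-∑₁ n = begin
    x                          ≡⟨ insert-o x o ⟩
    x + o + 0ℤ - o             ≡⟨ cong (λ k → x + o + + k - o) no-odd ⟨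
    x + o + r - o              ≡⟨ cong (_- o) (pmex-partial n (suc n)) ⟩
    + p (+ n) + ∑₁ (evenTerm n) (suc n) - o ∎
    where
    open ≡-Reasoning
    x  = + pmex A a n
    o  = ∑₁ (oddTerm n) (suc n)
    r  = + countOdd≥ n (suc n)
    insert-o : ∀ x o → x ≡ x + o + 0ℤ - o
    insert-o = solve-∀
    no-odd : countOdd≥ n (suc n) ≡ 0
    no-odd = count-none _ (partitions n) (λ xs∈ (2M≤k , _) →
      <⇒≱ (m≤m*n (suc n) 2) (≤-trans 2M≤k (mexIndex≤ xs∈)))

-- Series with finitely many nonzero terms

HasSum₁-finite : ∀ {f} N → (∀ r → N < r → f r ≡ 0ℤ) → HasSum₁ f (∑₁ f N)
HasSum₁-finite {f} N f≡0 = N , λ M N≤M → stable M (≤⇒≤′ N≤M)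
  where
  stable : ∀ M → N ℕ.≤′ M → ∑₁ f M ≡ ∑₁ f N
  stable M       ℕ.≤′-refl        = refl
  stable (suc M) (ℕ.≤′-step N≤′M) = trans
    (cong₂ _+_ (stable M N≤′M) (f≡0 (suc M) (s≤s (≤′⇒≤ N≤′M))))
    (+-identityʳ (∑₁ f N))

-- Agreement is asked at positive indices only, because `oddTerm` and its closed form may differ at
-- 0.
HasSum₁-cong : ∀ {f g s} → (∀ r → f (suc r) ≡ g (suc r)) → HasSum₁ f s → HasSum₁ g s
HasSum₁-cong {f} {g} f≗g (N , h) = N , λ M N≤M → trans (sym (∑₁-cong M)) (h M N≤M)
  where
  ∑₁-cong : ∀ M → ∑₁ f M ≡ ∑₁ g M
  ∑₁-cong zero    = refl
  ∑₁-cong (suc M) = cong₂ _+_ (∑₁-cong M) (f≗g M)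

-- Closed forms for A = mt and a = t

module _ (t m : ℕ) .{{_ : NonZero t}} .{{_ : NonZero m}} where

  private
    instance
      mt≢0 : NonZero (m ℕ.* t)
      mt≢0 = m*n≢0 m t

    T : ℕ → ℕ
    T j = sum (candidates (m ℕ.* t) t (m≤n*m t m) j)

  +candidate : ∀ j → + (t ℕ.+ j ℕ.* (m ℕ.* t)) ≡ + t + + j * (+ m * + t)
  +candidate j = cong (λ x → + t + x) (trans (pos-* j (m ℕ.* t)) (cong (λ x → + j * x) (pos-* m t)))

  sum-candidates-suc : ∀ j → + T (suc j) ≡ + t + + j * (+ m * + t) + + T j
  sum-candidates-suc j = cong (_+ + T j) (+candidate j)

  -- These are the values of jt + mt j(j-1)/2 at j = 2r and, with `suc r` as s, at j = 2s-1. Mutual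
  -- induction, each parity adding one candidate to the other, avoids the division by 2.
  sum-candidates-even : ∀ r → + T (r ℕ.* 2) ≡ + t * + r * (+ 2 * + r * + m - + m + + 2)
  sum-candidates-odd  : ∀ r → + T (suc (r ℕ.* 2)) ≡
    + t * (+ 2 * + suc r - + 1) * (+ suc r * + m - + m + + 1)

  sum-candidates-even zero = base (+ t) (+ m)
    where
    base : ∀ t m → 0ℤ ≡ t * 0ℤ * (+ 2 * 0ℤ * m - m + + 2)
    base = solve-∀
  sum-candidates-even (suc r) = begin
    + T (suc r ℕ.* 2)
      ≡⟨ sum-candidates-suc (suc (r ℕ.* 2)) ⟩
    + t + (+ 1 + + (r ℕ.* 2)) * (+ m * + t) + + T (suc (r ℕ.* 2))
      ≡⟨ cong₂ (λ i S → + t + (+ 1 + i) * (+ m * + t) + S) (pos-* r 2) (sum-candidates-odd r) ⟩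
    + t + (+ 1 + + r * + 2) * (+ m * + t) +
      + t * (+ 2 * (+ 1 + + r) - + 1) * ((+ 1 + + r) * + m - + m + + 1)
      ≡⟨ step (+ t) (+ m) (+ r) ⟩
    + t * + suc r * (+ 2 * + suc r * + m - + m + + 2)
      ∎
    where
    open ≡-Reasoning
    step : ∀ t m r →
      t + (+ 1 + r * + 2) * (m * t) + t * (+ 2 * (+ 1 + r) - + 1) * ((+ 1 + r) * m - m + + 1) ≡
      t * (+ 1 + r) * (+ 2 * (+ 1 + r) * m - m + + 2)
    step = solve-∀

  sum-candidates-odd r = begin
    + T (suc (r ℕ.* 2))
      ≡⟨ sum-candidates-suc (r ℕ.* 2) ⟩
    + t + + (r ℕ.* 2) * (+ m * + t) + + T (r ℕ.* 2)
      ≡⟨ cong₂ (λ i S → + t + i * (+ m * + t) + S) (pos-* r 2) (sum-candidates-even r) ⟩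
    + t + + r * + 2 * (+ m * + t) + + t * + r * (+ 2 * + r * + m - + m + + 2)
      ≡⟨ step (+ t) (+ m) (+ r) ⟩
    + t * (+ 2 * + suc r - + 1) * (+ suc r * + m - + m + + 1)
      ∎
    where
    open ≡-Reasoning
    step : ∀ t m r →
      t + r * + 2 * (m * t) + t * r * (+ 2 * r * m - m + + 2) ≡
      t * (+ 2 * (+ 1 + r) - + 1) * ((+ 1 + r) * m - m + + 1)
    step = solve-∀

theorem3p1 : (t m : ℕ) .{{_ : NonZero t}} .{{_ : NonZero m}} (n : ℕ) →
    ∃₂ λ (S₁ S₂ : ℤ) →
    HasSum₁ (λ r → + p (+ n - + t * + r * (+ 2 * + r * + m - + m + + 2))) S₁ ×
    HasSum₁ (λ s → + p (+ n - + t * (+ 2 * + s - + 1) * (+ s * + m - + m + + 1))) S₂ ×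
    + pmex (m ℕ.* t) t {{m*n≢0 m t}} n ≡ + p (+ n) + S₁ - S₂
theorem3p1 t m n =
    -- The cut-off `suc n` is that of `pmex-∑₁`; past it every term asks for an index greater than
    -- `n` and vanishes, so these partial sums are the full sums.
    ∑₁ (evenTerm A t t≤A n) (suc n)
  , ∑₁ (oddTerm A t t≤A n) (suc n)
  , HasSum₁-cong
      (λ r → cong +_ (trans (count≥≡p A t t≤A n (suc r ℕ.* 2))
        (cong (λ x → p (+ n - x)) (sum-candidates-even t m (suc r)))))
      (HasSum₁-finite (suc n) (λ r n<r → cong +_
        (count≥-zero A t t≤A (≤-trans (<⇒≤ n<r) (m≤m*n r 2)))))
  , HasSum₁-cong
      (λ r → cong +_ (trans (count≥≡p A t t≤A n (suc (r ℕ.* 2)))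
        (cong (λ x → p (+ n - x)) (sum-candidates-odd t m r))))
      (HasSum₁-finite (suc n) λ where
        (suc r) (s≤s n<r) → cong +_
          (count≥-zero A t t≤A (≤-trans n<r (≤-trans (m≤m*n r 2) (n≤1+n _)))))
  , pmex-∑₁ A t t≤A n
  where
  A = m ℕ.* t

  instance
    A≢0 : NonZero A
    A≢0 = m*n≢0 m t

  t≤A : t ≤ A
  t≤A = m≤n*m t m
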